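{- Fix an integer $k\ge 2$. Let $\kappa(r)=\kappa(m,r,s,u)$ be the formal power series in $r$ satisfying $$\kappa(r)=1-rs(m-1)\prod_{j=0}^{k-1}\kappa(rs^{j})-rs(m(u-1)+1)\prod_{j=0}^{k}\kappa(rs^{j}).$$ Then $$\kappa(r)=\sum_{n\ge 0}(-rs)^{n}\sum_{\mu\in\mathtt{Dyck}(n;k)}s^{|Y(\mu_{0}/\mu)|}\,\mathrm{wt}^{III}(\mu).$$
   Context: $m,s,u$ are formal variables, $m'=m-1$, $u'=u-1$, and power series in $r$ have coefficients in $\mathbb{Z}[m,s,u]$. A $k$-Dyck path of size $n$ is a lattice path from $(0,0)$ to $(kn,n)$ consisting of up steps $U=(0,1)$ and down steps $D=(1,0)$ which never goes below the line $y=x/k$; $\mathtt{Dyck}(n;k)$ is the set of them. $\mu_0=(UD^k)^n$ is the lowest path, and $|Y(\mu_0/\mu)|$ is the number of unit boxes above $\mu_0$ and below $\mu$. $\mathrm{Peak}(\mu)$ is the number of occurrences of the pattern $UD$ (consecutive steps) in $\mu$. For $\mu\in\mathtt{Dyck}(n;k)$, $$\mathrm{wt}^{III}(\mu)=(m'+1)^{\mathrm{Peak}(\mu)}(u'+1)^{\mathrm{Peak}(\mu)}(m'u'+u'+1)^{n-\mathrm{Peak}(\mu)}.$$ -}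

module Defs where

open import Level using (Level; _⊔_; 0ℓ)
open import Algebra.Bundles using (CommutativeRing; Semiring)
import Algebra.Definitions.RawSemiring as RawSemiringDefs
import Algebra.Properties.Ring as RingProperties
import Algebra.Properties.Semiring.Sum as SemiringSum
open import Data.Fin.Base using (Fin; zero; suc; toℕ)
open import Data.Integer.Properties using (+-*-commutativeRing)
open import Data.List.Base
  using (List; []; _∷_; _++_; map; foldr; filter; length; replicate; concat; upTo;
         cartesianProduct)
open import Data.List.Properties using (∷-injectiveʳ)
open import Data.List.Membership.Propositional using (_∈_)
open import Data.List.Membership.Propositional.Properties
  using (∈-map⁺; ∈-map⁻; ∈-++⁺ˡ; ∈-++⁺ʳ; ∈-filter⁺; ∈-filter⁻)
open import Data.List.Relation.Unary.All using (All; all?; []; _∷_)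
open import Data.List.Relation.Unary.Any using (Any; any?; here)
open import Data.List.Relation.Unary.Unique.Propositional using (Unique; []; _∷_)
import Data.List.Relation.Unary.Unique.Propositional.Properties as Unique
open import Data.Nat.Base as ℕ using (ℕ; zero; suc; _∸_; _≤_)
import Data.Nat.Properties as ℕ
open import Data.Product.Base using (_×_; _,_; proj₁; proj₂)
open import Data.Product.Properties using (≡-dec)
open import Data.Sum.Base using (inj₁; inj₂)
open import Function.Base using (_∘_)
open import Function.Bundles using (_⇔_; mk⇔)
open import Relation.Binary.PropositionalEquality as ≡ using (_≡_)
import Relation.Binary.Reasoning.Setoid as SetoidReasoning
open import Relation.Nullary.Decidable using (Dec; _×-dec_)

private variable
  c ℓ : Level

module PowerSeries (R : CommutativeRing c ℓ) where

  open CommutativeRing R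
  open RawSemiringDefs (Semiring.rawSemiring (CommutativeRing.semiring R)) using (_^_)
  open SemiringSum semiring
  open RingProperties ring using (-0#≈0#)
  open SetoidReasoning setoid

  -- f stands for ∑ₙ f(n) rⁿ.
  Series : Set c
  Series = ℕ → Carrier

  infix  4 _≋_
  infixl 6 _⊕_
  infixl 7 _⊛_

  _≋_ : Series → Series → Set ℓ
  f ≋ g = ∀ n → f n ≈ g n

  constant : Carrier → Series
  constant a zero    = a
  constant a (suc _) = 0#

  variable-r : Series
  variable-r zero    = 0#
  variable-r (suc n) = constant 1# n

  _⊕_ _⊛_ : Series → Series → Series
  (f ⊕ g) n = f n + g n
  (f ⊛ g) n = ∑[ i ≤ n ] (f (toℕ i) * g (n ∸ toℕ i))

  ⊖_ : Series → Series
  (⊖ f) n = - f n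

  -- The substitution r ↦ r a, i.e. f ⟨r· a ⟩ = f(r a).
  _⟨r·_⟩ : Series → Carrier → Series
  (f ⟨r· a ⟩) n = (a ^ n) * f n

  private
    tl : Series → Series
    tl f n = f (suc n)

    sum-zero : ∀ {n} (t : Fin n → Carrier) → (∀ i → t i ≈ 0#) → sum t ≈ 0#
    sum-zero {n} t t≈0 = trans (sum-cong-≋ t≈0) (sum-replicate-zero n)

  ⊛-cong : ∀ {f f′ g g′} → f ≋ f′ → g ≋ g′ → f ⊛ g ≋ f′ ⊛ g′
  ⊛-cong p q n = sum-cong-≋ {n = suc n} λ i → *-cong (p (toℕ i)) (q (n ∸ toℕ i))

  private
    ⊛-distribʳ : ∀ h f g → (f ⊕ g) ⊛ h ≋ f ⊛ h ⊕ g ⊛ h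
    ⊛-distribʳ h f g n = trans
      (sum-cong-≋ {n = suc n} λ i → distribʳ (h (n ∸ toℕ i)) (f (toℕ i)) (g (toℕ i)))
      (∑-distrib-+ {suc n} (λ i → f (toℕ i) * h (n ∸ toℕ i)) (λ i → g (toℕ i) * h (n ∸ toℕ i)))

    scale : ∀ a f g → (λ n → a * f n) ⊛ g ≋ (λ n → a * (f ⊛ g) n)
    scale a f g n = trans
      (sum-cong-≋ {n = suc n} λ i → *-assoc a (f (toℕ i)) (g (n ∸ toℕ i)))
      (sym (*-distribˡ-sum {suc n} a (λ i → f (toℕ i) * g (n ∸ toℕ i))))

    peelʳ : ∀ f g n → (f ⊛ g) (suc n) ≈ (f ⊛ tl g) n + f (suc n) * g 0
    peelʳ f g zero    = begin
      f 0 * g 1 + (f 1 * g 0 + 0#)  ≈⟨ +-congˡ (+-identityʳ _) ⟩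
      f 0 * g 1 + f 1 * g 0         ≈⟨ +-congʳ (+-identityʳ _) ⟨
      f 0 * g 1 + 0# + f 1 * g 0    ∎
    peelʳ f g (suc n) = begin
      f 0 * g (2 ℕ.+ n) + (tl f ⊛ g) (suc n)
        ≈⟨ +-congˡ (peelʳ (tl f) g n) ⟩
      f 0 * g (2 ℕ.+ n) + ((tl f ⊛ tl g) n + f (2 ℕ.+ n) * g 0)
        ≈⟨ +-assoc _ _ _ ⟨
      f 0 * g (2 ℕ.+ n) + (tl f ⊛ tl g) n + f (2 ℕ.+ n) * g 0  ∎

  ⊛-comm : ∀ f g → f ⊛ g ≋ g ⊛ f
  ⊛-comm f g zero    = +-congʳ (*-comm _ _)
  ⊛-comm f g (suc n) = begin
    f 0 * g (suc n) + (tl f ⊛ g) n  ≈⟨ +-comm _ _ ⟩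
    (tl f ⊛ g) n + f 0 * g (suc n)  ≈⟨ +-cong (⊛-comm (tl f) g n) (*-comm _ _) ⟩
    (g ⊛ tl f) n + g (suc n) * f 0  ≈⟨ peelʳ g f n ⟨
    (g ⊛ f) (suc n)                 ∎

  ⊛-assoc : ∀ f g h → (f ⊛ g) ⊛ h ≋ f ⊛ (g ⊛ h)
  ⊛-assoc f g h zero    = +-congʳ (begin
    (f 0 * g 0 + 0#) * h 0  ≈⟨ *-congʳ (+-identityʳ _) ⟩
    f 0 * g 0 * h 0         ≈⟨ *-assoc _ _ _ ⟩
    f 0 * (g 0 * h 0)       ≈⟨ *-congˡ (+-identityʳ _) ⟨
    f 0 * (g 0 * h 0 + 0#)  ∎)
  ⊛-assoc f g h (suc n) = begin
    (f 0 * g 0 + 0#) * h (suc n) + (tl (f ⊛ g) ⊛ h) n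
      ≈⟨ +-cong (trans (*-congʳ (+-identityʳ _)) (*-assoc _ _ _))
                (⊛-distribʳ h (λ i → f 0 * tl g i) (tl f ⊛ g) n) ⟩
    f 0 * (g 0 * h (suc n)) + (((λ i → f 0 * tl g i) ⊛ h) n + ((tl f ⊛ g) ⊛ h) n)
      ≈⟨ +-congˡ (+-cong (scale (f 0) (tl g) h n) (⊛-assoc (tl f) g h n)) ⟩
    f 0 * (g 0 * h (suc n)) + (f 0 * (tl g ⊛ h) n + (tl f ⊛ (g ⊛ h)) n)
      ≈⟨ +-assoc _ _ _ ⟨
    f 0 * (g 0 * h (suc n)) + f 0 * (tl g ⊛ h) n + (tl f ⊛ (g ⊛ h)) n
      ≈⟨ +-congʳ (distribˡ _ _ _) ⟨
    f 0 * (g ⊛ h) (suc n) + (tl f ⊛ (g ⊛ h)) n  ∎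

  ⊛-identityˡ : ∀ f → constant 1# ⊛ f ≋ f
  ⊛-identityˡ f zero    = trans (+-identityʳ _) (*-identityˡ _)
  ⊛-identityˡ f (suc n) = begin
    1# * f (suc n) + (tl (constant 1#) ⊛ f) n
      ≈⟨ +-cong (*-identityˡ _) (sum-zero {suc n} _ λ i → zeroˡ (f (n ∸ toℕ i))) ⟩
    f (suc n) + 0#  ≈⟨ +-identityʳ _ ⟩
    f (suc n)       ∎

  seriesRing : CommutativeRing c ℓ
  seriesRing = record
    { Carrier = Series
    ; _≈_ = _≋_
    ; _+_ = _⊕_
    ; _*_ = _⊛_
    ; -_ = ⊖_
    ; 0# = λ _ → 0#
    ; 1# = constant 1#
    ; isCommutativeRing = record
      { isRing = record
        { +-isAbelianGroup = record
          { isGroup = record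
            { isMonoid = record
              { isSemigroup = record
                { isMagma = record
                  { isEquivalence = record
                    { refl = λ n → refl
                    ; sym = λ p n → sym (p n)
                    ; trans = λ p q n → trans (p n) (q n)
                    }
                  ; ∙-cong = λ p q n → +-cong (p n) (q n)
                  }
                ; assoc = λ f g h n → +-assoc (f n) (g n) (h n)
                }
              ; identity = (λ f n → +-identityˡ (f n)) , (λ f n → +-identityʳ (f n))
              }
            ; inverse = (λ f n → -‿inverseˡ (f n)) , (λ f n → -‿inverseʳ (f n))
            ; ⁻¹-cong = λ p n → -‿cong (p n)
            }
          ; comm = λ f g n → +-comm (f n) (g n)
          }
        ; *-cong = λ {f} {f′} {g} {g′} → ⊛-cong {f} {f′} {g} {g′}
        ; *-assoc = ⊛-assoc
        ; *-identity = ⊛-identityˡ ,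
            λ f n → trans (⊛-comm f (constant 1#) n) (⊛-identityˡ f n)
        ; distrib =
            (λ f g h n → trans (⊛-comm f (g ⊕ h) n) (trans (⊛-distribʳ f g h n)
              (+-cong (⊛-comm g f n) (⊛-comm h f n)))) ,
            ⊛-distribʳ
        }
      ; *-comm = ⊛-comm
      }
    }

  VanishesFrom : ℕ → Series → Set ℓ
  VanishesFrom d f = ∀ n → d ≤ n → f n ≈ 0#

  ⊕-vanishes : ∀ {a b f g} → VanishesFrom a f → VanishesFrom b g →
               VanishesFrom (a ℕ.+ b) (f ⊕ g)
  ⊕-vanishes {a} {b} p q n a+b≤n = trans
    (+-cong (p n (ℕ.m+n≤o⇒m≤o a a+b≤n)) (q n (ℕ.m+n≤o⇒n≤o a a+b≤n))) (+-identityʳ 0#)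

  ⊖-vanishes : ∀ {a f} → VanishesFrom a f → VanishesFrom a (⊖ f)
  ⊖-vanishes p n a≤n = trans (-‿cong (p n a≤n)) -0#≈0#

  ⊛-vanishes : ∀ {a b f g} → VanishesFrom a f → VanishesFrom b g →
               VanishesFrom (a ℕ.+ b) (f ⊛ g)
  ⊛-vanishes {a} {b} {f} {g} p q n a+b≤n = sum-zero {suc n} _ λ i → term (toℕ i)
    where
    term : ∀ i → f i * g (n ∸ i) ≈ 0#
    term i with ℕ.≤-total a i
    ... | inj₁ a≤i = trans (*-congʳ (p i a≤i)) (zeroˡ _)
    ... | inj₂ i≤a = trans (*-congˡ (q (n ∸ i) (ℕ.≤-trans
      (ℕ.m+n≤o⇒m≤o∸n b (≡.subst (_≤ n) (ℕ.+-comm a b) a+b≤n)) (ℕ.∸-monoʳ-≤ n i≤a)))) (zeroʳ _)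

-- Polynomials in one variable are the finitely supported power series.
module Polynomials (R : CommutativeRing c ℓ) where

  open CommutativeRing R using (Carrier; refl; 0#; 1#)
  open PowerSeries R
  private module S = CommutativeRing seriesRing

  -- The bound is not required to be sharp and is ignored by the ring's
  -- equality, which compares coefficients only.
  record Polynomial : Set (c ⊔ ℓ) where
    field
      coeff    : ℕ → Carrier
      bound    : ℕ
      vanishes : VanishesFrom bound coeff
  open Polynomial

  constantₚ : Carrier → Polynomial
  constantₚ a = record
    { coeff = constant a ; bound = 1 ; vanishes = λ { (suc _) _ → refl } }

  variableₚ : Polynomial
  variableₚ = record
    { coeff = variable-r ; bound = 2 ; vanishes = λ { (suc (suc _)) (ℕ.s≤s _) → refl } }

  polynomialRing : CommutativeRing (c ⊔ ℓ) ℓ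
  polynomialRing = record
    { Carrier = Polynomial
    ; _≈_ = λ p q → coeff p ≋ coeff q
    ; _+_ = λ p q → record
        { coeff = coeff p ⊕ coeff q ; bound = bound p ℕ.+ bound q
        ; vanishes = ⊕-vanishes {f = coeff p} {coeff q} (vanishes p) (vanishes q) }
    ; _*_ = λ p q → record
        { coeff = coeff p ⊛ coeff q ; bound = bound p ℕ.+ bound q
        ; vanishes = ⊛-vanishes {f = coeff p} {coeff q} (vanishes p) (vanishes q) }
    ; -_ = λ p → record
        { coeff = ⊖ coeff p ; bound = bound p
        ; vanishes = ⊖-vanishes {f = coeff p} (vanishes p) }
    ; 0# = record { coeff = λ _ → 0# ; bound = 0 ; vanishes = λ _ _ → refl }
    ; 1# = constantₚ 1#
    ; isCommutativeRing = record
      { isRing = record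
        { +-isAbelianGroup = record
          { isGroup = record
            { isMonoid = record
              { isSemigroup = record
                { isMagma = record
                  { isEquivalence = record
                    { refl = S.refl ; sym = S.sym ; trans = S.trans }
                  ; ∙-cong = S.+-cong
                  }
                ; assoc = λ p q r → S.+-assoc (coeff p) (coeff q) (coeff r)
                }
              ; identity = S.+-identityˡ ∘ coeff , S.+-identityʳ ∘ coeff
              }
            ; inverse = S.-‿inverseˡ ∘ coeff , S.-‿inverseʳ ∘ coeff
            ; ⁻¹-cong = S.-‿cong
            }
          ; comm = λ p q → S.+-comm (coeff p) (coeff q)
          }
        ; *-cong = λ {p} {p′} {q} {q′} →
            ⊛-cong {coeff p} {coeff p′} {coeff q} {coeff q′}
        ; *-assoc = λ p q r → S.*-assoc (coeff p) (coeff q) (coeff r)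
        ; *-identity = S.*-identityˡ ∘ coeff , S.*-identityʳ ∘ coeff
        ; distrib = (λ p q r → S.distribˡ (coeff p) (coeff q) (coeff r)) ,
                    (λ p q r → S.distribʳ (coeff p) (coeff q) (coeff r))
        }
      ; *-comm = λ p q → S.*-comm (coeff p) (coeff q)
      }
    }

-- U = (0,1) and D = (1,0).
data Step : Set where
  U D : Step

Path : Set
Path = List Step

Point : Set
Point = ℕ × ℕ

move : Step → Point → Point
move U (x , y) = x , suc y
move D (x , y) = suc x , y

endpoint : Point → Path → Point
endpoint p []      = p
endpoint p (a ∷ μ) = endpoint (move a p) μ

vertices : Point → Path → List Point
vertices p []      = p ∷ []
vertices p (a ∷ μ) = p ∷ vertices (move a p) μ

-- y ≥ x / k, cleared of denominators.
NotBelowLine : ℕ → Point → Set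
NotBelowLine k (x , y) = x ≤ k ℕ.* y

-- Never going below the line needs to be checked at lattice points only,
-- since on every unit step y - x/k is monotone.
IsDyck : (n k : ℕ) → Path → Set
IsDyck n k μ =
  endpoint (0 , 0) μ ≡ (k ℕ.* n , n) × All (NotBelowLine k) (vertices (0 , 0) μ)

isDyck? : ∀ n k μ → Dec (IsDyck n k μ)
isDyck? n k μ = ≡-dec ℕ._≟_ ℕ._≟_ (endpoint (0 , 0) μ) (k ℕ.* n , n)
  ×-dec all? (λ (x , y) → x ℕ.≤? k ℕ.* y) (vertices (0 , 0) μ)

paths : ℕ → List Path
paths zero    = [] ∷ []
paths (suc l) = map (U ∷_) (paths l) ++ map (D ∷_) (paths l)

-- A duplicate-free list of all k-Dyck paths of size n
-- (see ∈-Dyck and Dyck-unique).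
Dyck : (n k : ℕ) → List Path
Dyck n k = filter (isDyck? n k) (paths (n ℕ.+ k ℕ.* n))

private
  ∈-paths : ∀ μ → μ ∈ paths (length μ)
  ∈-paths []      = here ≡.refl
  ∈-paths (U ∷ μ) = ∈-++⁺ˡ (∈-map⁺ (U ∷_) (∈-paths μ))
  ∈-paths (D ∷ μ) = ∈-++⁺ʳ (map (U ∷_) (paths (length μ))) (∈-map⁺ (D ∷_) (∈-paths μ))

  endpoint-length : ∀ (p : Point) (μ : Path) →
    proj₂ (endpoint p μ) ℕ.+ proj₁ (endpoint p μ) ≡ (proj₂ p ℕ.+ proj₁ p) ℕ.+ length μ
  endpoint-length (x , y) []      = ≡.sym (ℕ.+-identityʳ _)
  endpoint-length (x , y) (U ∷ μ) = ≡.trans (endpoint-length (x , suc y) μ)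
    (≡.sym (ℕ.+-suc (y ℕ.+ x) (length μ)))
  endpoint-length (x , y) (D ∷ μ) = ≡.trans (endpoint-length (suc x , y) μ)
    (≡.trans (≡.cong (ℕ._+ length μ) (ℕ.+-suc y x)) (≡.sym (ℕ.+-suc (y ℕ.+ x) (length μ))))

  paths-unique : ∀ l → Unique (paths l)
  paths-unique zero    = [] ∷ []
  paths-unique (suc l) = Unique.++⁺
    (Unique.map⁺ ∷-injectiveʳ (paths-unique l)) (Unique.map⁺ ∷-injectiveʳ (paths-unique l))
    λ (p , q) → disjoint (∈-map⁻ (U ∷_) p) (∈-map⁻ (D ∷_) q)
    where
    open import Data.Empty using (⊥)
    open import Data.Product.Base using (∃)
    disjoint : ∀ {μ} → ∃ (λ ν → ν ∈ paths l × μ ≡ U ∷ ν) →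
               ∃ (λ ν → ν ∈ paths l × μ ≡ D ∷ ν) → ⊥
    disjoint (_ , _ , ≡.refl) (_ , _ , ())

∈-Dyck : ∀ n k μ → μ ∈ Dyck n k ⇔ IsDyck n k μ
∈-Dyck n k μ = mk⇔ (λ i → proj₂ (∈-filter⁻ (isDyck? n k) {xs = paths (n ℕ.+ k ℕ.* n)} i))
  λ d → ∈-filter⁺ (isDyck? n k)
    (≡.subst (λ l → μ ∈ paths l) (len (proj₁ d)) (∈-paths μ)) d
  where
  len : endpoint (0 , 0) μ ≡ (k ℕ.* n , n) → length μ ≡ n ℕ.+ k ℕ.* n
  len e = ≡.trans (≡.sym (endpoint-length (0 , 0) μ))
    (≡.cong (λ p → proj₂ p ℕ.+ proj₁ p) e)

Dyck-unique : ∀ n k → Unique (Dyck n k)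
Dyck-unique n k = Unique.filter⁺ (isDyck? n k) (paths-unique (n ℕ.+ k ℕ.* n))

μ₀ : (n k : ℕ) → Path
μ₀ n k = concat (replicate n (U ∷ replicate k D))

-- Starting points of the down steps.
downs : Point → Path → List Point
downs p []      = []
downs p (U ∷ μ) = downs (move U p) μ
downs p (D ∷ μ) = p ∷ downs (move D p) μ

-- The point (i , j) also denotes the unit box [i,i+1] × [j,j+1].  The box is
-- above (below) a path when the step of the path spanning column [i,i+1]
-- runs at height ≤ j (≥ j+1).
AbovePath BelowPath : Path → Point → Set
AbovePath μ (i , j) = Any (λ (x , y) → x ≡ i × y ≤ j) (downs (0 , 0) μ)
BelowPath μ (i , j) = Any (λ (x , y) → x ≡ i × suc j ≤ y) (downs (0 , 0) μ)

abovePath? : ∀ μ b → Dec (AbovePath μ b)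
abovePath? μ (i , j) =
  any? (λ (x , y) → (x ℕ.≟ i) ×-dec (y ℕ.≤? j)) (downs (0 , 0) μ)

belowPath? : ∀ μ b → Dec (BelowPath μ b)
belowPath? μ (i , j) =
  any? (λ (x , y) → (x ℕ.≟ i) ×-dec (suc j ℕ.≤? y)) (downs (0 , 0) μ)

-- |Y(μ₀/μ)|; all boxes between the two paths lie in [0,kn] × [0,n].
∣Y∣ : (n k : ℕ) → Path → ℕ
∣Y∣ n k μ = length (filter (λ b → abovePath? (μ₀ n k) b ×-dec belowPath? μ b)
                           (cartesianProduct (upTo (k ℕ.* n)) (upTo n)))

Peak : Path → ℕ
Peak []          = 0
Peak (D ∷ μ)     = Peak μ
Peak (U ∷ [])    = 0
Peak (U ∷ U ∷ μ) = Peak (U ∷ μ)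
Peak (U ∷ D ∷ μ) = suc (Peak μ)

-- Stated over an arbitrary commutative ring with three chosen elements;
-- instantiated at the end with ℤ[m,s,u] and its variables.
module Kappa (R : CommutativeRing c ℓ) (m s u : CommutativeRing.Carrier R) where

  open PowerSeries R public using (Series; _≋_; constant; variable-r; _⟨r·_⟩)
  open PowerSeries R using (seriesRing)

  module _ where
    open CommutativeRing R
    open RawSemiringDefs (Semiring.rawSemiring (CommutativeRing.semiring R)) using (_^_)

    m′ u′ : Carrier
    m′ = m - 1#
    u′ = u - 1#

    wtᴵᴵᴵ : (n : ℕ) → Path → Carrier
    wtᴵᴵᴵ n μ = ((m′ + 1#) ^ Peak μ) * ((u′ + 1#) ^ Peak μ)
              * ((m′ * u′ + u′ + 1#) ^ (n ∸ Peak μ))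

    ∑Dyck : (n k : ℕ) → (Path → Carrier) → Carrier
    ∑Dyck n k w = foldr _+_ 0# (map w (Dyck n k))

    -- ∑ₙ (-rs)ⁿ ∑_{μ ∈ Dyck(n;k)} s^|Y(μ₀/μ)| wtᴵᴵᴵ(μ), via its coefficient of rⁿ.
    dyckSeries : ℕ → Series
    dyckSeries k n = ((- s) ^ n) * ∑Dyck n k (λ μ → (s ^ ∣Y∣ n k μ) * wtᴵᴵᴵ n μ)

  module _ where
    open CommutativeRing seriesRing
    open RawSemiringDefs (Semiring.rawSemiring (CommutativeRing.semiring R)) using (_^_)
    open RawSemiringDefs (Semiring.rawSemiring (CommutativeRing.semiring seriesRing)) using (product)

    -- ∏_{j=0}^{l-1} κ(r sʲ)
    ∏κ : ℕ → Series → Series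
    ∏κ l κ = product {l} (λ j → κ ⟨r· s ^ toℕ j ⟩)

    FunctionalEquation : ℕ → Series → Set ℓ
    FunctionalEquation k κ = κ ≈
        1# - r * S * (M - 1#) * ∏κ k κ
           - r * S * (M * (V - 1#) + 1#) * ∏κ (suc k) κ
      where
      r S M V : Series
      r = variable-r
      S = constant s
      M = constant m
      V = constant u

module ℤ[m]     = Polynomials +-*-commutativeRing
module ℤ[m,s]   = Polynomials ℤ[m].polynomialRing
module ℤ[m,s,u] = Polynomials ℤ[m,s].polynomialRing

ℤ[m,s,u] : CommutativeRing 0ℓ 0ℓ
ℤ[m,s,u] = ℤ[m,s,u].polynomialRing

var-m var-s var-u : CommutativeRing.Carrier ℤ[m,s,u]
var-m = ℤ[m,s,u].constantₚ (ℤ[m,s].constantₚ ℤ[m].variableₚ)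
var-s = ℤ[m,s,u].constantₚ ℤ[m,s].variableₚ
var-u = ℤ[m,s,u].variableₚ

open Kappa ℤ[m,s,u] var-m var-s var-u public
  using (_≋_; FunctionalEquation; dyckSeries)
  renaming (Series to ℤ[m,s,u]⟦r⟧)

{-# OPTIONS --safe #-}

-- Put G h = ∏_{j<h} κ(r sʲ).  Substituting r sʰ for r in the functional
-- equation and multiplying by G h gives, with a = m - 1 and b = m(u - 1) + 1,
--   G (h+1) = G h - r sʰ⁺¹ (b G (h+k+1) + a G (h+k)),   G 0 = 1,
-- which determines all G h.  Splitting off the first step shows that G (h+1) is
-- the sum over the paths that start at ky - x = h, end on the line and never go
-- below it, where an up step from height h carries - r sʰ⁺¹ times its weight:
-- a down step leads to height h - 1, and after an up step to height h + k the next
-- step is either arbitrary (weight b) or a down step (additional weight a, because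
-- a peak weighs mu = a + b).  The powers of s count the boxes row by row; for h = 0
-- the sum is the Dyck series and G 1 = κ.
module Submission where

open import Defs
open import Data.Nat using (ℕ; _≤_)

open import Algebra.Bundles using (CommutativeRing; Semiring)
import Algebra.Definitions.RawSemiring as RawSemiringDefs
import Algebra.Properties.CommutativeSemiring.Exp as Exp
import Algebra.Properties.Ring as RingProperties
import Algebra.Properties.Semiring.Sum as SemiringSum
import Algebra.Solver.Ring.NaturalCoefficients.Default as NaturalCoefficients
open import Data.Fin.Base as Fin using (Fin; toℕ)
open import Data.Fin.Properties using (toℕ≤pred[n])
open import Data.List.Base using (List; []; _∷_; _++_; _∷ʳ_; [_]; foldr; map; filter; length; replicate; iterate; applyUpTo; upTo; cartesianProduct)
open import Data.List.Membership.Propositional using (_∈_)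
open import Data.List.Membership.Propositional.Properties using (∈-cartesianProduct⁻)
open import Data.List.Properties using (length-++; filter-++; filter-accept; filter-reject; upTo-∷ʳ)
open import Data.List.Relation.Binary.Pointwise using (Pointwise; []; _∷_)
open import Data.List.Relation.Unary.All using (All; []; _∷_)
open import Data.List.Relation.Unary.Any using (Any; here; there; any?)
open import Data.Nat.Base as ℕ using (zero; suc; pred; _∸_; _⊓_; _<_; z≤n; s≤s)
open import Data.Nat.ListAction using (sum)
open import Data.Nat.ListAction.Properties using (sum-++)
import Data.Nat.Properties as ℕ
open import Data.Nat.Tactic.RingSolver using (solve-∀)
open import Data.Product.Base using (_×_; _,_; proj₁; proj₂; map₂)
open import Data.Product.Properties using (,-injectiveˡ; ,-injectiveʳ)
open import Function.Base using (_∘_)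
open import Function.Bundles using (_⇔_; mk⇔; module Equivalence)
open import Relation.Binary.PropositionalEquality as ≡ using (_≡_)
import Relation.Binary.Reasoning.Setoid as SetoidReasoning
open import Relation.Nullary using (¬_; yes; no; contradiction)
open import Relation.Nullary.Decidable using (Dec; _×-dec_)
open import Relation.Unary using (Decidable)

private variable
  k h e x y n : ℕ
  μ : Path

-- Dyck paths started at any distance from the line.

module DyckPaths where
  open import Data.Nat.Base using (_+_; _*_)
  open import Data.Nat.Properties
  open ≡ using (refl; sym; trans; cong; cong₂; subst; module ≡-Reasoning)

  -- DyckFrom k h e μ: the path μ starts at a point (x , y) with h = ky - x,
  -- has e up steps and never goes below the line, on which it ends.
  data DyckFrom (k : ℕ) : ℕ → ℕ → Path → Set where
    nil  : DyckFrom k 0 0 []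
    up   : DyckFrom k (h + k) e μ → DyckFrom k h (suc e) (U ∷ μ)
    down : DyckFrom k h e μ → DyckFrom k (suc h) e (D ∷ μ)

  endpoint-height : ∀ p μ → proj₂ p ≤ proj₂ (endpoint p μ)
  endpoint-height p       []      = ≤-refl
  endpoint-height (x , y) (U ∷ μ) = ≤-trans (n≤1+n y) (endpoint-height (x , suc y) μ)
  endpoint-height (x , y) (D ∷ μ) = endpoint-height (suc x , y) μ

  start-notBelow : ∀ {p} μ → All (NotBelowLine k) (vertices p μ) → NotBelowLine k p
  start-notBelow []      (q ∷ _) = q
  start-notBelow (_ ∷ μ) (q ∷ _) = q

  up-height : ∀ k x y h → x + h ≡ k * y → x + (h + k) ≡ k * suc y
  up-height k x y h eq = begin
    x + (h + k)  ≡⟨ +-assoc x h k ⟨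
    x + h + k    ≡⟨ cong (_+ k) eq ⟩
    k * y + k    ≡⟨ +-comm (k * y) k ⟩
    k + k * y    ≡⟨ *-suc k y ⟨
    k * suc y    ∎
    where open ≡-Reasoning

  -- The equations `x + h ≡ k * y` and `y + e ≡ n` are kept along the path. An up step at `e = 0`
  -- would pass the final height `n`, and a down step at `h = 0` would land below the line.
  toDyckFrom : ∀ μ → x + h ≡ k * y → y + e ≡ n →
               endpoint (x , y) μ ≡ (k * n , n) → All (NotBelowLine k) (vertices (x , y) μ) →
               DyckFrom k h e μ
  toDyckFrom {x} {h} {k} {y} {e} [] x+h≡ky y+e≡n end _
    with refl ← ,-injectiveʳ end
    with refl ← +-cancelˡ-≡ y e 0 (trans y+e≡n (sym (+-identityʳ y)))
    with refl ← +-cancelˡ-≡ x h 0 (trans x+h≡ky (trans (sym (,-injectiveˡ end)) (sym (+-identityʳ x))))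
    = nil
  toDyckFrom {y = y} {e = zero} (U ∷ μ) _ y+e≡n end _ = contradiction
    (subst (suc y ≤_) (,-injectiveʳ end) (endpoint-height (_ , suc y) μ))
    (≤⇒≯ (≤-reflexive (trans (sym y+e≡n) (+-identityʳ y))))
  toDyckFrom {x} {h} {k} {y} {e = suc e} (U ∷ μ) x+h≡ky y+e≡n end (_ ∷ above) =
    up (toDyckFrom μ (up-height k x y h x+h≡ky) (trans (sym (+-suc y e)) y+e≡n) end above)
  toDyckFrom {x} {zero} {k} {y} (D ∷ μ) x+h≡ky _ _ (_ ∷ above) = contradiction
    (start-notBelow {k} μ above) (≤⇒≯ (≤-reflexive (trans (sym x+h≡ky) (+-identityʳ x))))
  toDyckFrom {x} {suc h} (D ∷ μ) x+h≡ky y+e≡n end (_ ∷ above) =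
    down (toDyckFrom μ (trans (sym (+-suc x h)) x+h≡ky) y+e≡n end above)

  -- Every vertex satisfies `x + h ≡ k * y` for some natural number `h`, hence is not below the
  -- line.
  fromDyckFrom : x + h ≡ k * y → y + e ≡ n → DyckFrom k h e μ →
                 endpoint (x , y) μ ≡ (k * n , n) × All (NotBelowLine k) (vertices (x , y) μ)
  fromDyckFrom {x} {y = y} x+0≡ky y+0≡n nil
    with refl ← trans (sym (+-identityʳ y)) y+0≡n
    with refl ← trans (sym (+-identityʳ x)) x+0≡ky
    = refl , ≤-refl ∷ []
  fromDyckFrom {x} {h} {k} {y} {suc e} x+h≡ky y+e≡n (up d) =
    map₂ (m+n≤o⇒m≤o x (≤-reflexive x+h≡ky) ∷_)
      (fromDyckFrom (up-height k x y h x+h≡ky) (trans (sym (+-suc y e)) y+e≡n) d)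
  fromDyckFrom {x} {suc h} x+h≡ky y+e≡n (down d) =
    map₂ (m+n≤o⇒m≤o x (≤-reflexive x+h≡ky) ∷_)
      (fromDyckFrom (trans (sym (+-suc x h)) x+h≡ky) y+e≡n d)

  isDyck⇔DyckFrom : ∀ n k μ → IsDyck n k μ ⇔ DyckFrom k 0 n μ
  isDyck⇔DyckFrom n k μ = mk⇔
    (λ (end , above) → toDyckFrom μ (sym (*-zeroʳ k)) refl end above)
    (fromDyckFrom (sym (*-zeroʳ k)) refl)

  -- Every peak takes an up step of its own. The bound makes `suc e ∸ Peak μ` equal to
  -- `suc (e ∸ Peak μ)`, so the truncated subtraction in `wtᴵᴵᴵ` is exact.
  Peak≤ups : DyckFrom k h e μ → Peak μ ≤ e
  Peak≤ups nil                 = z≤n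
  Peak≤ups (down d)            = Peak≤ups d
  Peak≤ups (up {μ = []} d)     = z≤n
  Peak≤ups (up {μ = U ∷ _} d)  = m≤n⇒m≤1+n (Peak≤ups d)
  Peak≤ups (up {μ = D ∷ _} d)  = s≤s (Peak≤ups d)

  -- Area of a path by rows and by columns.

  -- Number of boxes between a path and the line, row by row: the row entered by
  -- an up step from (x , y) has ky - x of them.
  area : ℕ → ℕ → Path → ℕ
  area k h []      = 0
  area k h (U ∷ μ) = h + area k (h + k) μ
  area k h (D ∷ μ) = area k (pred h) μ

  heights : ℕ → Path → List ℕ
  heights y []      = []
  heights y (U ∷ μ) = heights (suc y) μ
  heights y (D ∷ μ) = y ∷ heights y μ

  -- The heights of the down steps of (U Dᵏ)ᵉ started at height y.
  lowest : ℕ → ℕ → ℕ → List ℕ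
  lowest k y zero    = []
  lowest k y (suc e) = replicate k (suc y) ++ lowest k (suc y) e

  heights-replicate : ∀ y j μ → heights y (replicate j D ++ μ) ≡ replicate j y ++ heights y μ
  heights-replicate y zero    μ = refl
  heights-replicate y (suc j) μ = cong (y ∷_) (heights-replicate y j μ)

  heights-μ₀ : ∀ y n k → heights y (μ₀ n k) ≡ lowest k y n
  heights-μ₀ y zero    k = refl
  heights-μ₀ y (suc n) k = trans (heights-replicate (suc y) k (μ₀ n k))
    (cong (replicate k (suc y) ++_) (heights-μ₀ (suc y) n k))

  sum-replicate : ∀ j y → sum (replicate j y) ≡ j * y
  sum-replicate zero    y = refl
  sum-replicate (suc j) y = cong (y +_) (sum-replicate j y)

  up-area : ∀ h k y a s → a + ((h + k) * suc y + s) ≡ h + a + (h * y + (k * suc y + s))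
  up-area = solve-∀

  down-area : ∀ h y a s → y + (a + (h * y + s)) ≡ a + (y + h * y + s)
  down-area = solve-∀

  -- The term `h * y + sum (lowest k y e)` belongs to the lowest continuation: `h` down steps, then
  -- `e` blocks U Dᵏ. An up step from height `y` lifts those `h` down steps by one level, which
  -- accounts for the `h` boxes of its row.
  sum-heights : DyckFrom k h e μ →
                sum (heights y μ) ≡ area k h μ + (h * y + sum (lowest k y e))
  sum-heights nil = refl
  sum-heights {k} {h} {suc e} {U ∷ μ} {y} (up d) = begin
    sum (heights (suc y) μ)
      ≡⟨ sum-heights d ⟩
    area k (h + k) μ + ((h + k) * suc y + sum (lowest k (suc y) e))
      ≡⟨ up-area h k y (area k (h + k) μ) _ ⟩
    h + area k (h + k) μ + (h * y + (k * suc y + sum (lowest k (suc y) e)))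
      ≡⟨ cong (λ t → h + area k (h + k) μ + (h * y + (t + sum (lowest k (suc y) e)))) (sum-replicate k (suc y)) ⟨
    h + area k (h + k) μ + (h * y + (sum (replicate k (suc y)) + sum (lowest k (suc y) e)))
      ≡⟨ cong (λ t → h + area k (h + k) μ + (h * y + t)) (sum-++ (replicate k (suc y)) _) ⟨
    h + area k (h + k) μ + (h * y + sum (lowest k y (suc e)))  ∎
    where open ≡-Reasoning
  sum-heights {k} {suc h} {e} {D ∷ μ} {y} (down d) =
    trans (cong (y +_) (sum-heights d)) (down-area h y (area k h μ) _)

  -- The left list belongs to the lowest continuation. After an up step its first `h` entries may be
  -- lowered from `suc y` to `y`.
  lowest≤heights : DyckFrom k h e μ → Pointwise _≤_ (replicate h y ++ lowest k y e) (heights y μ)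
  lowest≤heights nil      = []
  lowest≤heights (down d) = ≤-refl ∷ lowest≤heights d
  lowest≤heights {k} {h} {y = y} (up d) = lower h (lowest≤heights d)
    where
    lower : ∀ j {ys zs} → Pointwise _≤_ (replicate (j + k) (suc y) ++ zs) ys →
            Pointwise _≤_ (replicate j y ++ replicate k (suc y) ++ zs) ys
    lower zero    p       = p
    lower (suc j) (q ∷ p) = <⇒≤ q ∷ lower j p

  heights≤ : DyckFrom k h e μ → y + e ≡ n → All (_≤ n) (heights y μ)
  heights≤ nil      eq = []
  heights≤ {e = suc e} {y = y} (up d) eq = heights≤ d (trans (sym (+-suc y e)) eq)
  heights≤ {e = e} {y = y} (down d) eq = m+n≤o⇒m≤o y (≤-reflexive eq) ∷ heights≤ d eq

  length-heights : DyckFrom k h e μ → length (heights y μ) ≡ h + k * e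
  length-heights {k} nil = sym (*-zeroʳ k)
  length-heights {k} {h} {suc e} (up d) = trans (length-heights d)
    (trans (+-assoc h k (k * e)) (cong (h +_) (sym (*-suc k e))))
  length-heights (down d) = cong suc (length-heights d)

  -- Counting the boxes between two paths column by column.

  columns : ℕ → List ℕ → List Point
  columns x []       = []
  columns x (y ∷ ys) = (x , y) ∷ columns (suc x) ys

  downs≡columns : ∀ x y μ → downs (x , y) μ ≡ columns x (heights y μ)
  downs≡columns x y []      = refl
  downs≡columns x y (U ∷ μ) = downs≡columns x (suc y) μ
  downs≡columns x y (D ∷ μ) = cong ((x , y) ∷_) (downs≡columns (suc x) y μ)

  module _ {a p q} {A : Set a} {P : A → Set p} {Q : A → Set q}
           (P? : Decidable P) (Q? : Decidable Q) where

    length-filter-cong : ∀ xs → (∀ {z} → z ∈ xs → P z ⇔ Q z) →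
                         length (filter P? xs) ≡ length (filter Q? xs)
    length-filter-cong []       _ = refl
    length-filter-cong (z ∷ xs) P⇔Q with P? z | Q? z
    ... | yes _  | yes _  = cong suc (length-filter-cong xs λ i → P⇔Q (there i))
    ... | no _   | no _   = length-filter-cong xs λ i → P⇔Q (there i)
    ... | yes Pz | no ¬Qz = contradiction (Equivalence.to (P⇔Q (here refl)) Pz) ¬Qz
    ... | no ¬Pz | yes Qz = contradiction (Equivalence.from (P⇔Q (here refl)) Qz) ¬Pz

  length-filter-map : ∀ {a b p} {A : Set a} {B : Set b} {P : B → Set p} (P? : Decidable P) (f : A → B) xs →
                      length (filter P? (map f xs)) ≡ length (filter (λ z → P? (f z)) xs)
  length-filter-map P? f []       = refl
  length-filter-map P? f (z ∷ xs) with P? (f z)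
  ... | yes _ = cong suc (length-filter-map P? f xs)
  ... | no _  = length-filter-map P? f xs

  between? : ∀ l b j → Dec (l ≤ j × suc j ≤ b)
  between? l b j = (l ≤? j) ×-dec (suc j ≤? b)

  length-between : ∀ l b n → length (filter (between? l b) (upTo n)) ≡ (b ⊓ n) ∸ l
  length-between l b zero    = sym (trans (cong (_∸ l) (⊓-zeroʳ b)) (0∸n≡0 l))
  length-between l b (suc n) = begin
    length (filter (between? l b) (upTo (suc n)))
      -- Removing the last index leaves `upTo n` as it is, ready for the induction hypothesis;
      -- removing the first would shift all others.
      ≡⟨ cong (λ t → length (filter (between? l b) t)) (upTo-∷ʳ n) ⟨
    length (filter (between? l b) (upTo n ∷ʳ n))
      ≡⟨ cong length (filter-++ (between? l b) (upTo n) [ n ]) ⟩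
    length (filter (between? l b) (upTo n) ++ filter (between? l b) [ n ])
      ≡⟨ length-++ (filter (between? l b) (upTo n)) ⟩
    length (filter (between? l b) (upTo n)) + length (filter (between? l b) [ n ])
      ≡⟨ cong (_+ length (filter (between? l b) [ n ])) (length-between l b n) ⟩
    (b ⊓ n) ∸ l + length (filter (between? l b) [ n ])
      ≡⟨ last ⟩
    (b ⊓ suc n) ∸ l  ∎
    where
    open ≡-Reasoning
    -- The index `n` counts exactly when `l ≤ n` and `n < b`. Otherwise either both minima are `b`
    -- or both truncated differences are 0.
    last : (b ⊓ n) ∸ l + length (filter (between? l b) [ n ]) ≡ (b ⊓ suc n) ∸ l
    last with l ≤? n | suc n ≤? b
    ... | yes l≤n | yes n<b = begin
      (b ⊓ n) ∸ l + length (filter (between? l b) [ n ])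
        ≡⟨ cong₂ (λ t u → t ∸ l + length u) (m≥n⇒m⊓n≡n (<⇒≤ n<b)) (filter-accept (between? l b) (l≤n , n<b)) ⟩
      n ∸ l + 1        ≡⟨ +-comm (n ∸ l) 1 ⟩
      suc (n ∸ l)      ≡⟨ +-∸-assoc 1 l≤n ⟨
      suc n ∸ l        ≡⟨ cong (_∸ l) (m≥n⇒m⊓n≡n n<b) ⟨
      (b ⊓ suc n) ∸ l  ∎
    ... | yes _ | no n≮b = begin
      (b ⊓ n) ∸ l + length (filter (between? l b) [ n ])
        ≡⟨ cong₂ (λ t u → t ∸ l + length u) (m≤n⇒m⊓n≡m (≮⇒≥ n≮b))
             (filter-reject (between? l b) (λ p → n≮b (proj₂ p))) ⟩
      b ∸ l + 0        ≡⟨ +-identityʳ _ ⟩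
      b ∸ l            ≡⟨ cong (_∸ l) (m≤n⇒m⊓n≡m (m≤n⇒m≤1+n (≮⇒≥ n≮b))) ⟨
      (b ⊓ suc n) ∸ l  ∎
    ... | no l≰n | _ = begin
      (b ⊓ n) ∸ l + length (filter (between? l b) [ n ])
        ≡⟨ cong₂ (λ t u → t + length u) (m≤n⇒m∸n≡0 (≤-trans (m⊓n≤n b n) (<⇒≤ (≰⇒> l≰n))))
             (filter-reject (between? l b) (λ p → l≰n (proj₁ p))) ⟩
      0                ≡⟨ m≤n⇒m∸n≡0 (≤-trans (m⊓n≤n b (suc n)) (≰⇒> l≰n)) ⟨
      (b ⊓ suc n) ∸ l  ∎

  -- `AbovePath` and `BelowPath` with the list of points as an argument, so that the count can
  -- proceed by induction on the columns.
  OnOrAbove Under : Point → List Point → Set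
  OnOrAbove (i , j) = Any (λ (x , y) → x ≡ i × y ≤ j)
  Under     (i , j) = Any (λ (x , y) → x ≡ i × suc j ≤ y)

  boxBetween? : ∀ ps qs b → Dec (OnOrAbove b ps × Under b qs)
  boxBetween? ps qs (i , j) = any? (λ (x , y) → (x ≟ i) ×-dec (y ≤? j)) ps
    ×-dec any? (λ (x , y) → (x ≟ i) ×-dec (suc j ≤? y)) qs

  column-bound : ∀ {p} {P : ℕ → Set p} x {i} ys → Any (λ (z , y) → z ≡ i × P y) (columns x ys) → x ≤ i
  column-bound x (y ∷ ys) (here (refl , _)) = ≤-refl
  column-bound x (y ∷ ys) (there a)         = <⇒≤ (column-bound (suc x) ys a)

  ∈-iterate⇒≤ : ∀ x l {i} → i ∈ iterate suc x l → x ≤ i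
  ∈-iterate⇒≤ x (suc l) (here refl) = ≤-refl
  ∈-iterate⇒≤ x (suc l) (there i∈)  = <⇒≤ (∈-iterate⇒≤ (suc x) l i∈)

  -- Later entries lie in columns beyond `x`, so the head alone decides about a box in column `x`.
  headColumn : ∀ {p} {P : ℕ → Set p} x y ys → Any (λ (z , y) → z ≡ x × P y) (columns x (y ∷ ys)) ⇔ P y
  headColumn {P = P} x y ys = mk⇔ to (λ p → here (refl , p))
    where
    to : Any (λ (z , y) → z ≡ x × P y) (columns x (y ∷ ys)) → P y
    to (here (_ , p)) = p
    to (there a)      = contradiction (column-bound (suc x) ys a) 1+n≰n

  tailColumns : ∀ {p} {P : ℕ → Set p} x y ys {i} → x < i →
                Any (λ (z , y) → z ≡ i × P y) (columns x (y ∷ ys)) ⇔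
                Any (λ (z , y) → z ≡ i × P y) (columns (suc x) ys)
  tailColumns {P = P} x y ys {i} x<i = mk⇔ to there
    where
    to : Any (λ (z , y) → z ≡ i × P y) (columns x (y ∷ ys)) →
         Any (λ (z , y) → z ≡ i × P y) (columns (suc x) ys)
    to (here (refl , _)) = contradiction x<i 1+n≰n
    to (there a)         = a

  ×-⇔ : ∀ {a b c d} {A : Set a} {B : Set b} {C : Set c} {E : Set d} →
        A ⇔ B → C ⇔ E → (A × C) ⇔ (B × E)
  ×-⇔ f g = mk⇔ (λ (a , c) → Equivalence.to f a , Equivalence.to g c)
                (λ (b , e) → Equivalence.from f b , Equivalence.from g e)

  -- In a single column the bounds `g ≤ b ≤ n` give exactly `b ∸ g` boxes. The lower sum is added on
  -- the left so that no difference of sums occurs.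
  boxes+sum : ∀ n x {gs hs} → Pointwise _≤_ gs hs → All (_≤ n) hs →
              length (filter (boxBetween? (columns x gs) (columns x hs))
                             (cartesianProduct (iterate suc x (length hs)) (upTo n)))
                + sum gs ≡ sum hs
  boxes+sum n x [] [] = refl
  boxes+sum n x {g ∷ gs} {b ∷ hs} (g≤b ∷ gs≤hs) (b≤n ∷ hs≤n) = begin
    length (filter box? (map (x ,_) (upTo n) ++ rest)) + (g + sum gs)
      ≡⟨ cong (λ t → length t + (g + sum gs)) (filter-++ box? (map (x ,_) (upTo n)) rest) ⟩
    length (filter box? (map (x ,_) (upTo n)) ++ filter box? rest) + (g + sum gs)
      ≡⟨ cong (_+ (g + sum gs)) (length-++ (filter box? (map (x ,_) (upTo n)))) ⟩
    length (filter box? (map (x ,_) (upTo n))) + length (filter box? rest) + (g + sum gs)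
      ≡⟨ cong₂ (λ p q → p + q + (g + sum gs)) first others ⟩
    b ∸ g + length (filter box?′ rest) + (g + sum gs)
      ≡⟨ interchange (b ∸ g) _ g (sum gs) ⟩
    b ∸ g + g + (length (filter box?′ rest) + sum gs)
      ≡⟨ cong₂ _+_ (m∸n+n≡m g≤b) (boxes+sum n (suc x) gs≤hs hs≤n) ⟩
    b + sum hs  ∎
    where
    open ≡-Reasoning
    box?  = boxBetween? (columns x (g ∷ gs)) (columns x (b ∷ hs))
    box?′ = boxBetween? (columns (suc x) gs) (columns (suc x) hs)
    rest  = cartesianProduct (iterate suc (suc x) (length hs)) (upTo n)

    interchange : ∀ a b c d → a + b + (c + d) ≡ a + c + (b + d)
    interchange = solve-∀

    first : length (filter box? (map (x ,_) (upTo n))) ≡ b ∸ g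
    first = begin
      length (filter box? (map (x ,_) (upTo n)))
        ≡⟨ length-filter-map box? (x ,_) (upTo n) ⟩
      length (filter (λ j → box? (x , j)) (upTo n))
        ≡⟨ length-filter-cong (λ j → box? (x , j)) (between? g b) (upTo n)
             (λ _ → ×-⇔ (headColumn x g gs) (headColumn x b hs)) ⟩
      length (filter (between? g b) (upTo n))
        ≡⟨ length-between g b n ⟩
      (b ⊓ n) ∸ g
        ≡⟨ cong (_∸ g) (m≤n⇒m⊓n≡m b≤n) ⟩
      b ∸ g  ∎

    others : length (filter box? rest) ≡ length (filter box?′ rest)
    others = length-filter-cong box? box?′ rest λ i → let
      x<i = ∈-iterate⇒≤ (suc x) (length hs)
              (proj₁ (∈-cartesianProduct⁻ (iterate suc (suc x) (length hs)) (upTo n) i))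
      in ×-⇔ (tailColumns x g gs x<i) (tailColumns x b hs x<i)

  -- The induction in `boxes+sum` moves the starting column, which `iterate suc x` shows and `upTo`
  -- does not.
  applyUpTo≡iterate : ∀ (f : ℕ → ℕ) x l → (∀ i → f i ≡ x + i) → applyUpTo f l ≡ iterate suc x l
  applyUpTo≡iterate f x zero    f≗ = refl
  applyUpTo≡iterate f x (suc l) f≗ = cong₂ _∷_ (trans (f≗ 0) (+-identityʳ x))
    (applyUpTo≡iterate (λ i → f (suc i)) (suc x) l λ i → trans (f≗ (suc i)) (+-suc x i))

  -- Counting by columns and counting by rows both give the sum of the heights of `μ` minus that of
  -- `μ₀`. The latter is added to both sides and then cancelled.
  ∣Y∣≡area : DyckFrom k 0 n μ → ∣Y∣ n k μ ≡ area k 0 μ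
  ∣Y∣≡area {k} {n} {μ} d = +-cancelʳ-≡ (sum (lowest k 0 n)) _ _ (begin
    ∣Y∣ n k μ + sum (lowest k 0 n)
      ≡⟨ cong (λ l → length (filter box? (cartesianProduct l (upTo n))) + sum (lowest k 0 n)) columns-range ⟩
    length (filter box? (cartesianProduct (iterate suc 0 (length (heights 0 μ))) (upTo n))) + sum (lowest k 0 n)
      ≡⟨ cong₂ (λ ps qs → length (filter (boxBetween? ps qs)
           (cartesianProduct (iterate suc 0 (length (heights 0 μ))) (upTo n))) + sum (lowest k 0 n))
           (trans (downs≡columns 0 0 (μ₀ n k)) (cong (columns 0) (heights-μ₀ 0 n k)))
           (downs≡columns 0 0 μ) ⟩
    length (filter (boxBetween? (columns 0 (lowest k 0 n)) (columns 0 (heights 0 μ)))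
      (cartesianProduct (iterate suc 0 (length (heights 0 μ))) (upTo n))) + sum (lowest k 0 n)
      ≡⟨ boxes+sum n 0 (lowest≤heights d) (heights≤ d refl) ⟩
    sum (heights 0 μ)
      ≡⟨ sum-heights d ⟩
    area k 0 μ + sum (lowest k 0 n)  ∎)
    where
    open ≡-Reasoning
    box? = boxBetween? (downs (0 , 0) (μ₀ n k)) (downs (0 , 0) μ)
    columns-range : upTo (k * n) ≡ iterate suc 0 (length (heights 0 μ))
    columns-range = trans (applyUpTo≡iterate (λ i → i) 0 (k * n) λ _ → refl)
      (cong (iterate suc 0) (sym (length-heights d)))

open DyckPaths

-- Finite sums over lists, in particular over lists of paths.

module ListSums {c ℓ} (R : CommutativeRing c ℓ) where
  open CommutativeRing R hiding (zero)
  open SetoidReasoning setoid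

  ∑ : ∀ {a} {A : Set a} → List A → (A → Carrier) → Carrier
  ∑ xs f = foldr _+_ 0# (map f xs)

  module _ {a} {A : Set a} where

    ∑-zero : ∀ (xs : List A) → ∑ xs (λ _ → 0#) ≈ 0#
    ∑-zero []       = refl
    ∑-zero (x ∷ xs) = trans (+-identityˡ _) (∑-zero xs)

    ∑-++ : ∀ (f : A → Carrier) xs ys → ∑ (xs ++ ys) f ≈ ∑ xs f + ∑ ys f
    ∑-++ f []       ys = sym (+-identityˡ _)
    ∑-++ f (x ∷ xs) ys = trans (+-congˡ (∑-++ f xs ys)) (sym (+-assoc _ _ _))

    ∑-distribˡ : ∀ b (f : A → Carrier) xs → ∑ xs (λ x → b * f x) ≈ b * ∑ xs f
    ∑-distribˡ b f []       = sym (zeroʳ b)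
    ∑-distribˡ b f (x ∷ xs) = trans (+-congˡ (∑-distribˡ b f xs)) (sym (distribˡ b _ _))

    ∑-map : ∀ {b} {B : Set b} (f : B → Carrier) (φ : A → B) xs → ∑ (map φ xs) f ≡ ∑ xs (f ∘ φ)
    ∑-map f φ []       = ≡.refl
    ∑-map f φ (x ∷ xs) = ≡.cong (f (φ x) +_) (∑-map f φ xs)

    -- Serves to pass from Dyck paths to all paths of a given length, which can be split by their
    -- first step; the new summand has to vanish on the rejected paths.
    ∑-filter : ∀ {p} {P : A → Set p} (P? : Decidable P) {f g : A → Carrier} xs →
               (∀ x → P x → f x ≈ g x) → (∀ x → ¬ P x → g x ≈ 0#) → ∑ (filter P? xs) f ≈ ∑ xs g
    ∑-filter P? []       f≈g g≈0 = refl
    ∑-filter P? (x ∷ xs) f≈g g≈0 with P? x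
    ... | yes Px = +-cong (f≈g x Px) (∑-filter P? xs f≈g g≈0)
    ... | no ¬Px = trans (sym (+-identityˡ _)) (+-cong (sym (g≈0 x ¬Px)) (∑-filter P? xs f≈g g≈0))

  ∑-paths : ∀ l (f : Path → Carrier) →
            ∑ (paths (suc l)) f ≈ ∑ (paths l) (f ∘ (U ∷_)) + ∑ (paths l) (f ∘ (D ∷_))
  ∑-paths l f = trans (∑-++ f (map (U ∷_) (paths l)) _)
    (reflexive (≡.cong₂ _+_ (∑-map f (U ∷_) (paths l)) (∑-map f (D ∷_) (paths l))))

-- Path weights and the Dyck series.

module WeightedPaths {c ℓ} (R : CommutativeRing c ℓ) (m s u : CommutativeRing.Carrier R) where
  open CommutativeRing R hiding (zero)
  open RawSemiringDefs (Semiring.rawSemiring semiring) using (_^_)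
  open Exp commutativeSemiring using (^-homo-*)
  open NaturalCoefficients commutativeSemiring using (solve; _:=_; _:+_; _:*_; con)
  open SetoidReasoning setoid
  open Kappa R m s u using (m′; u′; wtᴵᴵᴵ)
  open PowerSeries R using (Series; constant)
  open ListSums R

  peak-weight nonpeak-weight : Carrier
  peak-weight    = (m′ + 1#) * (u′ + 1#)
  nonpeak-weight = m′ * u′ + u′ + 1#

  -- Weight of an up step followed by the given path.
  upWeight : Path → Carrier
  upWeight (D ∷ _) = peak-weight
  upWeight _       = nonpeak-weight

  -- The summand of the path in the Dyck series as a product over its steps;
  -- it is 0 unless DyckFrom k h e μ.
  pathWeight : ℕ → Path → ℕ → ℕ → Carrier
  pathWeight k []      zero    zero    = 1#
  pathWeight k []      zero    (suc e) = 0#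
  pathWeight k []      (suc h) e       = 0#
  pathWeight k (U ∷ μ) h       zero    = 0#
  pathWeight k (U ∷ μ) h       (suc e) = - s * s ^ h * (upWeight μ * pathWeight k μ (h ℕ.+ k) e)
  pathWeight k (D ∷ μ) zero    e       = 0#
  pathWeight k (D ∷ μ) (suc h) e       = pathWeight k μ h e

  pathWeight-¬Dyck : ∀ h e μ → ¬ DyckFrom k h e μ → pathWeight k μ h e ≈ 0#
  pathWeight-¬Dyck zero    zero    []      ¬d = contradiction nil ¬d
  pathWeight-¬Dyck zero    (suc e) []      ¬d = refl
  pathWeight-¬Dyck (suc h) e       []      ¬d = refl
  pathWeight-¬Dyck h       zero    (U ∷ μ) ¬d = refl
  pathWeight-¬Dyck h       (suc e) (U ∷ μ) ¬d =
    trans (*-congˡ (trans (*-congˡ (pathWeight-¬Dyck _ e μ (¬d ∘ up))) (zeroʳ _))) (zeroʳ _)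
  pathWeight-¬Dyck zero    e       (D ∷ μ) ¬d = refl
  pathWeight-¬Dyck (suc h) e       (D ∷ μ) ¬d = pathWeight-¬Dyck h e μ (¬d ∘ down)

  -- The new up step makes a peak exactly when `μ` begins with a down step; otherwise the exponent
  -- of `nonpeak-weight` grows by one.
  upWeight-wt : DyckFrom k h e μ → upWeight μ * wtᴵᴵᴵ e μ ≈ wtᴵᴵᴵ (suc e) (U ∷ μ)
  upWeight-wt {e = e} {μ = []} d =
    solve 2 (λ b w → b :* (con 1 :* con 1 :* w) := con 1 :* con 1 :* (b :* w)) refl
      nonpeak-weight (nonpeak-weight ^ e)
  upWeight-wt {e = e} {μ = U ∷ μ} d = begin
    b * (xP * yP * b ^ (e ∸ P))
      ≈⟨ solve 4 (λ b x y w → b :* (x :* y :* w) := x :* y :* (b :* w)) refl b xP yP (b ^ (e ∸ P)) ⟩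
    xP * yP * b ^ suc (e ∸ P)
      ≡⟨ ≡.cong (λ j → xP * yP * b ^ j) (ℕ.+-∸-assoc 1 (Peak≤ups d)) ⟨
    xP * yP * b ^ (suc e ∸ P)  ∎
    where
    b  = nonpeak-weight
    P  = Peak (U ∷ μ)
    xP = (m′ + 1#) ^ P
    yP = (u′ + 1#) ^ P
  upWeight-wt {e = e} {μ = D ∷ μ} d =
    solve 5 (λ x y xP yP w → (x :* y) :* (xP :* yP :* w) := (x :* xP) :* (y :* yP) :* w) refl
      (m′ + 1#) (u′ + 1#) ((m′ + 1#) ^ Peak μ) ((u′ + 1#) ^ Peak μ) (nonpeak-weight ^ (e ∸ Peak μ))

  -- Each up step brings one factor `- s` and, for the `h` boxes of its row, the factor `s ^ h`.
  pathWeight-Dyck : DyckFrom k h e μ →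
                    pathWeight k μ h e ≈ (- s) ^ e * (s ^ area k h μ * wtᴵᴵᴵ e μ)
  pathWeight-Dyck nil = solve 0 (con 1 := con 1 :* (con 1 :* (con 1 :* con 1 :* con 1))) refl
  pathWeight-Dyck {k} {h} {suc e} {U ∷ μ} (up d) = begin
    - s * s ^ h * (upWeight μ * pathWeight k μ (h ℕ.+ k) e)
      ≈⟨ *-congˡ (*-congˡ (pathWeight-Dyck d)) ⟩
    - s * s ^ h * (upWeight μ * ((- s) ^ e * (s ^ A * wtᴵᴵᴵ e μ)))
      ≈⟨ solve 6 (λ q sh v qe sA w → q :* sh :* (v :* (qe :* (sA :* w))) :=
           q :* qe :* ((sh :* sA) :* (v :* w))) refl
           (- s) (s ^ h) (upWeight μ) ((- s) ^ e) (s ^ A) (wtᴵᴵᴵ e μ) ⟩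
    (- s) ^ suc e * (s ^ h * s ^ A * (upWeight μ * wtᴵᴵᴵ e μ))
      ≈⟨ *-congˡ (*-cong (sym (^-homo-* s h A)) (upWeight-wt d)) ⟩
    (- s) ^ suc e * (s ^ (h ℕ.+ A) * wtᴵᴵᴵ (suc e) (U ∷ μ))  ∎
    where A = area k (h ℕ.+ k) μ
  pathWeight-Dyck (down d) = pathWeight-Dyck d

  dyckSeries≈∑pathWeight : ∀ k n →
    Kappa.dyckSeries R m s u k n ≈ ∑ (paths (n ℕ.+ k ℕ.* n)) (λ μ → pathWeight k μ 0 n)
  dyckSeries≈∑pathWeight k n = trans (sym (∑-distribˡ ((- s) ^ n) _ (Dyck n k)))
    (∑-filter (isDyck? n k) (paths (n ℕ.+ k ℕ.* n))
      (λ μ dyck → let d = Equivalence.to (isDyck⇔DyckFrom n k μ) dyck in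
        trans (reflexive (≡.cong (λ j → (- s) ^ n * (s ^ j * wtᴵᴵᴵ n μ)) (∣Y∣≡area d)))
              (sym (pathWeight-Dyck d)))
      (λ μ ¬dyck → pathWeight-¬Dyck 0 n μ (¬dyck ∘ Equivalence.from (isDyck⇔DyckFrom n k μ))))

  -- Summation over paths by their first steps.

  ∑-upWeight : ∀ l (f : Path → Carrier) →
               ∑ (paths (suc l)) (λ μ → upWeight μ * f μ) ≈
               nonpeak-weight * ∑ (paths (suc l)) f + m′ * ∑ (paths l) (f ∘ (D ∷_))
  ∑-upWeight l f = begin
    ∑ (paths (suc l)) (λ μ → upWeight μ * f μ)
      ≈⟨ ∑-paths l (λ μ → upWeight μ * f μ) ⟩
    ∑ (paths l) (λ μ → nonpeak-weight * f (U ∷ μ)) + ∑ (paths l) (λ μ → peak-weight * f (D ∷ μ))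
      ≈⟨ +-cong (∑-distribˡ nonpeak-weight (f ∘ (U ∷_)) (paths l))
                (∑-distribˡ peak-weight (f ∘ (D ∷_)) (paths l)) ⟩
    nonpeak-weight * ∑ (paths l) (f ∘ (U ∷_)) + peak-weight * ∑ (paths l) (f ∘ (D ∷_))
      -- Since `peak-weight` is `nonpeak-weight + m′`, every continuation is charged
      -- `nonpeak-weight`, and those beginning with a down step are charged `m′` in addition.
      ≈⟨ solve 4 (λ m u p q →
           (m :* u :+ u :+ con 1) :* p :+ ((m :+ con 1) :* (u :+ con 1)) :* q :=
           (m :* u :+ u :+ con 1) :* (p :+ q) :+ m :* q) refl
           m′ u′ (∑ (paths l) (f ∘ (U ∷_))) (∑ (paths l) (f ∘ (D ∷_))) ⟩
    nonpeak-weight * (∑ (paths l) (f ∘ (U ∷_)) + ∑ (paths l) (f ∘ (D ∷_))) + m′ * ∑ (paths l) (f ∘ (D ∷_))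
      ≈⟨ +-congʳ (*-congˡ (∑-paths l f)) ⟨
    nonpeak-weight * ∑ (paths (suc l)) f + m′ * ∑ (paths l) (f ∘ (D ∷_))  ∎

  -- The coefficients of the recurrence for `G`: at index 0 the term with the factor r drops out,
  -- and elsewhere this factor lowers the index by one.
  record FirstStepRecursion (k : ℕ) (G : ℕ → Series) : Set ℓ where
    field
      base    : ∀ n → G 0 n ≈ constant 1# n
      initial : ∀ h → G (suc h) 0 ≈ G h 0
      step    : ∀ h n → G (suc h) (suc n) ≈
                G h (suc n) + - s * s ^ h * (nonpeak-weight * G (suc (h ℕ.+ k)) n + m′ * G (h ℕ.+ k) n)

  module _ {k : ℕ} {G : ℕ → Series} (1≤k : 1 ≤ k) (rec : FirstStepRecursion k G) where
    open FirstStepRecursion rec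

    -- Induction on the length, which is forced: `e` up steps and `k * e + h` down steps remain. The
    -- offset in `G (suc h)` leaves `G 0` for the forbidden down step from height 0.
    ∑pathWeight : ∀ l h e → l ≡ e ℕ.+ k ℕ.* e ℕ.+ h → ∑ (paths l) (λ μ → pathWeight k μ h e) ≈ G (suc h) e
    -- The weight of an up step depends on the step after it, so the rest of the path is split once
    -- more. It is nonempty because at least `k` down steps are still to come.
    ∑pathWeight-up : ∀ l h e → l ≡ e ℕ.+ k ℕ.* e ℕ.+ (h ℕ.+ k) →
      ∑ (paths l) (λ μ → pathWeight k (U ∷ μ) h (suc e)) ≈
      - s * s ^ h * (nonpeak-weight * G (suc (h ℕ.+ k)) e + m′ * G (h ℕ.+ k) e)
    ∑pathWeight-down : ∀ l h e → suc l ≡ e ℕ.+ k ℕ.* e ℕ.+ h →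
      ∑ (paths l) (λ μ → pathWeight k (D ∷ μ) h e) ≈ G h e

    ∑pathWeight zero zero zero _ = begin
      1# + 0#        ≈⟨ +-identityʳ 1# ⟩
      1#             ≈⟨ base 0 ⟨
      G 0 0          ≈⟨ initial 0 ⟨
      G 1 0          ∎
    ∑pathWeight zero (suc h) zero eq = contradiction eq
      (ℕ.<⇒≢ (ℕ.<-≤-trans ℕ.z<s (ℕ.m≤n+m (suc h) (k ℕ.* 0))))
    ∑pathWeight (suc l) h zero eq = begin
      ∑ (paths (suc l)) (λ μ → pathWeight k μ h 0)
        ≈⟨ ∑-paths l (λ μ → pathWeight k μ h 0) ⟩
      ∑ (paths l) (λ μ → pathWeight k (U ∷ μ) h 0) + ∑ (paths l) (λ μ → pathWeight k (D ∷ μ) h 0)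
        ≈⟨ +-cong (∑-zero (paths l)) (∑pathWeight-down l h 0 eq) ⟩
      0# + G h 0
        ≈⟨ +-identityˡ _ ⟩
      G h 0
        ≈⟨ initial h ⟨
      G (suc h) 0  ∎
    ∑pathWeight (suc l) h (suc e) eq = begin
      ∑ (paths (suc l)) (λ μ → pathWeight k μ h (suc e))
        ≈⟨ ∑-paths l (λ μ → pathWeight k μ h (suc e)) ⟩
      ∑ (paths l) (λ μ → pathWeight k (U ∷ μ) h (suc e)) + ∑ (paths l) (λ μ → pathWeight k (D ∷ μ) h (suc e))
        ≈⟨ +-cong (∑pathWeight-up l h e (ℕ.suc-injective (≡.trans eq (rearrange e h k))))
                  (∑pathWeight-down l h (suc e) eq) ⟩
      - s * s ^ h * (nonpeak-weight * G (suc (h ℕ.+ k)) e + m′ * G (h ℕ.+ k) e) + G h (suc e)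
        ≈⟨ +-comm _ _ ⟩
      G h (suc e) + - s * s ^ h * (nonpeak-weight * G (suc (h ℕ.+ k)) e + m′ * G (h ℕ.+ k) e)
        ≈⟨ step h e ⟨
      G (suc h) (suc e)  ∎
      where
      rearrange : ∀ e h k → suc e ℕ.+ k ℕ.* suc e ℕ.+ h ≡ suc (e ℕ.+ k ℕ.* e ℕ.+ (h ℕ.+ k))
      rearrange = solve-∀

    ∑pathWeight-up zero h e eq = contradiction eq
      (ℕ.<⇒≢ (ℕ.≤-trans 1≤k (ℕ.≤-trans (ℕ.m≤n+m k h) (ℕ.m≤n+m (h ℕ.+ k) (e ℕ.+ k ℕ.* e)))))
    ∑pathWeight-up (suc l) h e eq = begin
      ∑ (paths (suc l)) (λ μ → pathWeight k (U ∷ μ) h (suc e))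
        ≈⟨ ∑-distribˡ (- s * s ^ h) (λ μ → upWeight μ * pathWeight k μ (h ℕ.+ k) e) (paths (suc l)) ⟩
      - s * s ^ h * ∑ (paths (suc l)) (λ μ → upWeight μ * pathWeight k μ (h ℕ.+ k) e)
        ≈⟨ *-congˡ (∑-upWeight l (λ μ → pathWeight k μ (h ℕ.+ k) e)) ⟩
      - s * s ^ h * (nonpeak-weight * ∑ (paths (suc l)) (λ μ → pathWeight k μ (h ℕ.+ k) e) +
                     m′ * ∑ (paths l) (λ μ → pathWeight k (D ∷ μ) (h ℕ.+ k) e))
        ≈⟨ *-congˡ (+-cong (*-congˡ (∑pathWeight (suc l) (h ℕ.+ k) e eq))
                           (*-congˡ (∑pathWeight-down l (h ℕ.+ k) e eq))) ⟩
      - s * s ^ h * (nonpeak-weight * G (suc (h ℕ.+ k)) e + m′ * G (h ℕ.+ k) e)  ∎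

    -- At height 0 no down step is allowed. For `e = 0` the length equation fails; for larger `e`
    -- the zero sum matches a higher coefficient of the constant series 1.
    ∑pathWeight-down l zero    zero    eq = contradiction
      (≡.trans eq (≡.trans (ℕ.+-identityʳ _) (ℕ.*-zeroʳ k))) λ ()
    ∑pathWeight-down l zero    (suc e) eq = trans (∑-zero (paths l)) (sym (base (suc e)))
    ∑pathWeight-down l (suc h) e       eq =
      ∑pathWeight l h e (ℕ.suc-injective (≡.trans eq (ℕ.+-suc (e ℕ.+ k ℕ.* e) h)))

-- Ring identities behind the recurrence.

module RingIdentities {c ℓ} (R : CommutativeRing c ℓ) where
  open CommutativeRing R hiding (zero)
  open RingProperties ring using (-‿distribˡ-*; -‿distribʳ-*)
  open NaturalCoefficients commutativeSemiring using (solve; _:=_; _:+_; _:*_; con)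
  open SetoidReasoning setoid

  -- Prepares the functional equation for the form `shift`. Once the signs are moved into `- a`, an
  -- identity of commutative semirings remains.
  collect : ∀ r a b p c q →
            1# - r * a * b * p - r * a * c * q ≈ 1# + r * (- a * (c * q + b * p))
  collect r a b p c q = begin
    1# - r * a * b * p - r * a * c * q
      ≈⟨ +-cong (+-congˡ (negate b p)) (negate c q) ⟩
    1# + r * - a * b * p + r * - a * c * q
      ≈⟨ solve 6 (λ r a b p c q → con 1 :+ r :* a :* b :* p :+ r :* a :* c :* q :=
           con 1 :+ r :* (a :* (c :* q :+ b :* p))) refl r (- a) b p c q ⟩
    1# + r * (- a * (c * q + b * p))  ∎
    where
    negate : ∀ x y → - (r * a * x * y) ≈ r * - a * x * y
    negate x y = trans (-‿distribˡ-* (r * a * x) y)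
      (*-congʳ (trans (-‿distribˡ-* (r * a) x) (*-congʳ (-‿distribʳ-* r a))))

  multiply-through : ∀ g r a b p c q → g * (1# + r * (a * (c * q + b * p))) ≈
                     g + r * (a * (c * (g * q) + b * (g * p)))
  multiply-through = solve 7 (λ g r a b p c q → g :* (con 1 :+ r :* (a :* (c :* q :+ b :* p))) :=
    g :+ r :* (a :* (c :* (g :* q) :+ b :* (g :* p)))) refl

-- Power series: constants, the factor r and rescaling of r.

module SeriesProperties {c ℓ} (R : CommutativeRing c ℓ) where
  open CommutativeRing R hiding (zero)
  open RawSemiringDefs (Semiring.rawSemiring semiring) using (_^_)
  open Exp commutativeSemiring using (^-homo-*; ^-congˡ)
  open RingProperties ring using (-0#≈0#)
  open SemiringSum semiring using (sum-cong-≋; sum-replicate-zero; *-distribˡ-sum)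
  open NaturalCoefficients commutativeSemiring using (solve; _:=_; _:*_)
  open PowerSeries R hiding (_≋_)
  open SetoidReasoning setoid
  private module S = CommutativeRing seriesRing
  open RawSemiringDefs (Semiring.rawSemiring S.semiring) using (product)

  constant-⊛ : ∀ a f n → (constant a ⊛ f) n ≈ a * f n
  constant-⊛ a f zero    = +-identityʳ _
  constant-⊛ a f (suc n) = trans
    (+-congˡ (trans (sum-cong-≋ {suc n} λ i → zeroˡ (f (n ∸ toℕ i))) (sum-replicate-zero (suc n))))
    (+-identityʳ _)

  r-⊛-zero : ∀ f → (variable-r ⊛ f) 0 ≈ 0#
  r-⊛-zero f = trans (+-identityʳ _) (zeroˡ _)

  r-⊛-suc : ∀ f n → (variable-r ⊛ f) (suc n) ≈ f n
  r-⊛-suc f n = begin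
    0# * f (suc n) + (constant 1# ⊛ f) n  ≈⟨ +-cong (zeroˡ _) (⊛-identityˡ f n) ⟩
    0# + f n                              ≈⟨ +-identityˡ _ ⟩
    f n                                   ∎

  constant-⊕ : ∀ a b → constant (a + b) S.≈ constant a ⊕ constant b
  constant-⊕ a b zero    = refl
  constant-⊕ a b (suc n) = sym (+-identityʳ 0#)

  constant-⊖ : ∀ a → constant (- a) S.≈ ⊖ constant a
  constant-⊖ a zero    = refl
  constant-⊖ a (suc n) = sym -0#≈0#

  constant-* : ∀ a b → constant (a * b) S.≈ constant a ⊛ constant b
  constant-* a b zero    = sym (constant-⊛ a (constant b) 0)
  constant-* a b (suc n) = sym (trans (constant-⊛ a (constant b) (suc n)) (zeroʳ a))

  constant-cong : ∀ {a b} → a ≈ b → constant a S.≈ constant b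
  constant-cong a≈b zero    = a≈b
  constant-cong a≈b (suc n) = refl

  -- In each term of the convolution `a ^ n` splits into `a ^ i` and `a ^ (n ∸ i)`.
  ⟨r·⟩-⊛ : ∀ a f g → (f ⊛ g) ⟨r· a ⟩ S.≈ (f ⟨r· a ⟩) ⊛ (g ⟨r· a ⟩)
  ⟨r·⟩-⊛ a f g n = trans (*-distribˡ-sum {suc n} (a ^ n) (λ i → f (toℕ i) * g (n ∸ toℕ i)))
    (sum-cong-≋ {suc n} λ i → term (toℕ i) (toℕ≤pred[n] i))
    where
    term : ∀ i → i ≤ n → a ^ n * (f i * g (n ∸ i)) ≈ a ^ i * f i * (a ^ (n ∸ i) * g (n ∸ i))
    term i i≤n = begin
      a ^ n * (f i * g (n ∸ i))
        ≡⟨ ≡.cong (λ j → a ^ j * (f i * g (n ∸ i))) (ℕ.m+[n∸m]≡n i≤n) ⟨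
      a ^ (i ℕ.+ (n ∸ i)) * (f i * g (n ∸ i))
        ≈⟨ *-congʳ (^-homo-* a i (n ∸ i)) ⟩
      a ^ i * a ^ (n ∸ i) * (f i * g (n ∸ i))
        ≈⟨ solve 4 (λ p q x y → p :* q :* (x :* y) := p :* x :* (q :* y)) refl _ _ _ _ ⟩
      a ^ i * f i * (a ^ (n ∸ i) * g (n ∸ i))  ∎

  ⟨r·⟩-⟨r·⟩ : ∀ a i j f → (f ⟨r· a ^ j ⟩) ⟨r· a ^ i ⟩ S.≈ f ⟨r· a ^ (i ℕ.+ j) ⟩
  ⟨r·⟩-⟨r·⟩ a i j f n = begin
    (a ^ i) ^ n * ((a ^ j) ^ n * f n)  ≈⟨ *-assoc _ _ _ ⟨
    (a ^ i) ^ n * (a ^ j) ^ n * f n    ≈⟨ *-congʳ (Exp.^-distrib-* commutativeSemiring (a ^ i) (a ^ j) n) ⟨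
    (a ^ i * a ^ j) ^ n * f n          ≈⟨ *-congʳ (^-congˡ n (^-homo-* a i j)) ⟨
    (a ^ (i ℕ.+ j)) ^ n * f n          ∎

  ⟨r·⟩-1 : ∀ a → constant 1# ⟨r· a ⟩ S.≈ constant 1#
  ⟨r·⟩-1 a zero    = *-identityʳ 1#
  ⟨r·⟩-1 a (suc n) = zeroʳ _

  -- Products of consecutive factors `κ ⟨r· s ^ j ⟩`.

  module _ (s : Carrier) (κ : Series) where

    -- ∏_{c ≤ j < c + l} κ(r sʲ)
    ∏κ-from : ℕ → ℕ → Series
    ∏κ-from c zero    = constant 1#
    ∏κ-from c (suc l) = (κ ⟨r· s ^ c ⟩) ⊛ ∏κ-from (suc c) l

    -- The exponents form a general `f` because the recursion of `product` replaces `f` by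
    -- `f ∘ Fin.suc`; the equation for `f` records the starting index.
    product≈∏κ-from : ∀ c l (f : Fin l → ℕ) → (∀ j → f j ≡ c ℕ.+ toℕ j) →
                      product {l} (λ j → κ ⟨r· s ^ f j ⟩) S.≈ ∏κ-from c l
    product≈∏κ-from c zero    f f≗ = S.refl
    product≈∏κ-from c (suc l) f f≗ = S.*-cong
      {κ ⟨r· s ^ f Fin.zero ⟩} {κ ⟨r· s ^ c ⟩}
      (S.reflexive (≡.cong (λ i → κ ⟨r· s ^ i ⟩) (≡.trans (f≗ Fin.zero) (ℕ.+-identityʳ c))))
      (product≈∏κ-from (suc c) l (f ∘ Fin.suc) λ j → ≡.trans (f≗ (Fin.suc j)) (ℕ.+-suc c (toℕ j)))

    ∏κ-from-+ : ∀ c h l → ∏κ-from c (h ℕ.+ l) S.≈ ∏κ-from c h ⊛ ∏κ-from (c ℕ.+ h) l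
    ∏κ-from-+ c zero    l = S.trans
      (S.reflexive (≡.cong (λ i → ∏κ-from i l) (≡.sym (ℕ.+-identityʳ c))))
      (S.sym (⊛-identityˡ (∏κ-from (c ℕ.+ 0) l)))
    ∏κ-from-+ c (suc h) l = S.trans
      (S.*-congˡ {κ ⟨r· s ^ c ⟩} (S.trans (∏κ-from-+ (suc c) h l)
        (S.reflexive (≡.cong (λ i → ∏κ-from (suc c) h ⊛ ∏κ-from i l) (≡.sym (ℕ.+-suc c h))))))
      (S.sym (⊛-assoc (κ ⟨r· s ^ c ⟩) (∏κ-from (suc c) h) (∏κ-from (c ℕ.+ suc h) l)))

    -- Substitution respects products, and on a single factor the exponents `h` and `c` add up.
    ∏κ-from-⟨r·⟩ : ∀ h c l → (∏κ-from c l) ⟨r· s ^ h ⟩ S.≈ ∏κ-from (h ℕ.+ c) l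
    ∏κ-from-⟨r·⟩ h c zero    = ⟨r·⟩-1 (s ^ h)
    ∏κ-from-⟨r·⟩ h c (suc l) = S.trans
      (⟨r·⟩-⊛ (s ^ h) (κ ⟨r· s ^ c ⟩) (∏κ-from (suc c) l))
      (⊛-cong {(κ ⟨r· s ^ c ⟩) ⟨r· s ^ h ⟩} {κ ⟨r· s ^ (h ℕ.+ c) ⟩}
              {(∏κ-from (suc c) l) ⟨r· s ^ h ⟩} {∏κ-from (suc (h ℕ.+ c)) l}
        (⟨r·⟩-⟨r·⟩ s h c κ)
        (S.trans (∏κ-from-⟨r·⟩ h (suc c) l)
          (S.reflexive (≡.cong (λ i → ∏κ-from i l) (ℕ.+-suc h c)))))

-- From the functional equation to the recurrence and the Dyck series.

module KappaSeries {c ℓ} (R : CommutativeRing c ℓ) (m s u : CommutativeRing.Carrier R) where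
  open CommutativeRing R hiding (zero)
  open RawSemiringDefs (Semiring.rawSemiring semiring) using (_^_)
  open Kappa R m s u using (m′; u′; ∏κ)
  open PowerSeries R hiding (_≋_)
  open SeriesProperties R
  open WeightedPaths R m s u
  private module S = CommutativeRing seriesRing

  -- Writing `m` as `m′ + 1#` turns the coefficient in the functional equation into the weight of an
  -- up step outside peaks.
  nonpeak-weight≈ : m * u′ + 1# ≈ nonpeak-weight
  nonpeak-weight≈ = begin
    m * u′ + 1#            ≈⟨ +-congʳ (*-congʳ m≈m′+1) ⟩
    (m′ + 1#) * u′ + 1#    ≈⟨ +-congʳ (trans (distribʳ u′ m′ 1#) (+-congˡ (*-identityˡ u′))) ⟩
    m′ * u′ + u′ + 1#      ∎
    where
    open SetoidReasoning setoid
    m≈m′+1 : m ≈ m′ + 1#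
    m≈m′+1 = sym (trans (+-assoc m (- 1#) 1#) (trans (+-congˡ (-‿inverseˡ 1#)) (+-identityʳ m)))

  module _ {k : ℕ} {κ : Series} (functional : Kappa.FunctionalEquation R m s u k κ) where

    G : ℕ → Series
    G = ∏κ-from s κ 0

    combination : Carrier → Series → Series → Series
    combination q y x = constant q ⊛ (constant nonpeak-weight ⊛ y ⊕ constant m′ ⊛ x)

    combination-coefficient : ∀ q y x n →
                              combination q y x n ≈ q * (nonpeak-weight * y n + m′ * x n)
    combination-coefficient q y x n = trans
      (constant-⊛ q (constant nonpeak-weight ⊛ y ⊕ constant m′ ⊛ x) n)
      (*-congˡ (+-cong (constant-⊛ nonpeak-weight y n) (constant-⊛ m′ x n)))

    -- g + r q ((m(u - 1) + 1) y + (m - 1) x)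
    shift : Series → Carrier → Series → Series → Series
    shift g q y x = g ⊕ variable-r ⊛ combination q y x

    shift-zero : ∀ g q y x → shift g q y x 0 ≈ g 0
    shift-zero g q y x = trans (+-congˡ (r-⊛-zero (combination q y x))) (+-identityʳ (g 0))

    shift-suc : ∀ g q y x n →
                shift g q y x (suc n) ≈ g (suc n) + q * (nonpeak-weight * y n + m′ * x n)
    shift-suc g q y x n = +-congˡ
      (trans (r-⊛-suc (combination q y x) n) (combination-coefficient q y x n))

    κ≈shift : κ S.≈ shift S.1# (- s) (G (suc k)) (G k)
    κ≈shift = begin
      κ
        ≈⟨ functional ⟩
      S.1# S.- r S.* A S.* (constant m S.- S.1#) S.* ∏κ k κ
           S.- r S.* A S.* (constant m S.* (constant u S.- S.1#) S.+ S.1#) S.* ∏κ (suc k) κ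
        ≈⟨ S.+-cong (S.+-congˡ (S.-‿cong (S.*-cong (S.*-congˡ {r S.* A} (constant-minus-1 m)) (∏κ≈G k))))
                    (S.-‿cong (S.*-cong (S.*-congˡ {r S.* A} constant-nonpeak) (∏κ≈G (suc k)))) ⟩
      S.1# S.- r S.* A S.* B S.* G k S.- r S.* A S.* C S.* G (suc k)
        ≈⟨ RingIdentities.collect seriesRing r A B (G k) C (G (suc k)) ⟩
      S.1# S.+ r S.* (S.- A S.* (C S.* G (suc k) S.+ B S.* G k))
        ≈⟨ S.+-congˡ {S.1#} (S.*-congˡ {r} (S.*-congʳ {x = C S.* G (suc k) S.+ B S.* G k} (constant-⊖ s))) ⟨
      shift S.1# (- s) (G (suc k)) (G k)  ∎
      where
      open SetoidReasoning S.setoid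
      r = variable-r
      A = constant s
      B = constant m′
      C = constant nonpeak-weight
      ∏κ≈G : ∀ l → ∏κ l κ S.≈ G l
      ∏κ≈G l = product≈∏κ-from s κ 0 l toℕ λ _ → ≡.refl
      constant-minus-1 : ∀ a → constant a S.- S.1# S.≈ constant (a - 1#)
      constant-minus-1 a = S.trans (S.+-congˡ {constant a} (S.sym (constant-⊖ 1#)))
        (S.sym (constant-⊕ a (- 1#)))
      constant-nonpeak : constant m S.* (constant u S.- S.1#) S.+ S.1# S.≈ C
      constant-nonpeak = begin
        constant m S.* (constant u S.- S.1#) S.+ S.1#
          ≈⟨ S.+-congʳ {S.1#} (S.*-congˡ {constant m} (constant-minus-1 u)) ⟩
        constant m S.* constant u′ S.+ S.1#
          ≈⟨ S.+-congʳ {S.1#} (constant-* m u′) ⟨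
        constant (m * u′) S.+ S.1#
          ≈⟨ constant-⊕ (m * u′) 1# ⟨
        constant (m * u′ + 1#)
          ≈⟨ constant-cong nonpeak-weight≈ ⟩
        C  ∎

    -- At index `suc n` the factor `t * t ^ n` is shared out: `t` joins `- s`, and `t ^ n` moves the
    -- starting index of both products from 0 to `h`.
    κ⟨r·⟩≈shift : ∀ h → κ ⟨r· s ^ h ⟩ S.≈
                  shift S.1# (- s * s ^ h) (∏κ-from s κ h (suc k)) (∏κ-from s κ h k)
    κ⟨r·⟩≈shift h zero = begin
      1# * κ 0  ≈⟨ *-identityˡ _ ⟩
      κ 0       ≈⟨ trans (κ≈shift 0) (shift-zero S.1# (- s) (G (suc k)) (G k)) ⟩
      1#        ≈⟨ shift-zero S.1# (- s * s ^ h) (∏κ-from s κ h (suc k)) (∏κ-from s κ h k) ⟨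
      shift S.1# (- s * s ^ h) (∏κ-from s κ h (suc k)) (∏κ-from s κ h k) 0  ∎
      where open SetoidReasoning setoid
    κ⟨r·⟩≈shift h (suc n) = begin
      t * t ^ n * κ (suc n)
        ≈⟨ *-congˡ (trans (κ≈shift (suc n)) (shift-suc S.1# (- s) (G (suc k)) (G k) n)) ⟩
      t * t ^ n * (0# + - s * (nonpeak-weight * G (suc k) n + m′ * G k n))
        ≈⟨ solve 7 (λ t tn q b y a x → t :* tn :* (con 0 :+ q :* (b :* y :+ a :* x)) :=
             con 0 :+ q :* t :* (b :* (tn :* y) :+ a :* (tn :* x))) refl
             t (t ^ n) (- s) nonpeak-weight (G (suc k) n) m′ (G k n) ⟩
      0# + - s * t * (nonpeak-weight * (t ^ n * G (suc k) n) + m′ * (t ^ n * G k n))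
        ≈⟨ +-congˡ (*-congˡ (+-cong (*-congˡ (scaled (suc k))) (*-congˡ (scaled k)))) ⟩
      0# + - s * t * (nonpeak-weight * ∏κ-from s κ h (suc k) n + m′ * ∏κ-from s κ h k n)
        ≈⟨ shift-suc S.1# (- s * t) (∏κ-from s κ h (suc k)) (∏κ-from s κ h k) n ⟨
      shift S.1# (- s * t) (∏κ-from s κ h (suc k)) (∏κ-from s κ h k) (suc n)  ∎
      where
      open SetoidReasoning setoid
      open NaturalCoefficients commutativeSemiring using (solve; _:=_; _:+_; _:*_; con)
      t = s ^ h
      scaled : ∀ l → t ^ n * G l n ≈ ∏κ-from s κ h l n
      scaled l = trans (∏κ-from-⟨r·⟩ s κ h 0 l n)
        (reflexive (≡.cong (λ i → ∏κ-from s κ i l n) (ℕ.+-identityʳ h)))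

    -- The last factor of `G (suc h)` has exponent `h` and is expanded; multiplication by `G h` then
    -- extends the products starting at `h` to products starting at 0.
    G-shift : ∀ h → G (suc h) S.≈ shift (G h) (- s * s ^ h) (G (suc (h ℕ.+ k))) (G (h ℕ.+ k))
    G-shift h = begin
      G (suc h)
        ≡⟨ ≡.cong G (ℕ.+-comm 1 h) ⟩
      G (h ℕ.+ 1)
        ≈⟨ ∏κ-from-+ s κ 0 h 1 ⟩
      G h S.* ((κ ⟨r· s ^ h ⟩) S.* S.1#)
        ≈⟨ S.*-congˡ {G h} (S.trans (S.*-identityʳ (κ ⟨r· s ^ h ⟩)) (κ⟨r·⟩≈shift h)) ⟩
      G h S.* shift S.1# q (∏κ-from s κ h (suc k)) (∏κ-from s κ h k)
        ≈⟨ RingIdentities.multiply-through seriesRing (G h) variable-r (constant q)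
             (constant m′) (∏κ-from s κ h k) (constant nonpeak-weight) (∏κ-from s κ h (suc k)) ⟩
      shift (G h) q (G h S.* ∏κ-from s κ h (suc k)) (G h S.* ∏κ-from s κ h k)
        ≈⟨ S.+-congˡ {G h} (S.*-congˡ {variable-r} (S.*-congˡ {constant q} (S.+-cong
             (S.*-congˡ {constant nonpeak-weight} (∏κ-from-+ s κ 0 h (suc k)))
             (S.*-congˡ {constant m′} (∏κ-from-+ s κ 0 h k))))) ⟨
      shift (G h) q (G (h ℕ.+ suc k)) (G (h ℕ.+ k))
        ≡⟨ ≡.cong (λ i → shift (G h) q (G i) (G (h ℕ.+ k))) (ℕ.+-suc h k) ⟩
      shift (G h) q (G (suc (h ℕ.+ k))) (G (h ℕ.+ k))  ∎
      where
      open SetoidReasoning S.setoid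
      q = - s * s ^ h

    G-recursion : FirstStepRecursion k G
    G-recursion = record
      { base    = λ n → refl
      ; initial = λ h → trans (G-shift h 0) (shift-zero (G h) (- s * s ^ h) (G (suc (h ℕ.+ k))) (G (h ℕ.+ k)))
      ; step    = λ h n → trans (G-shift h (suc n)) (shift-suc (G h) (- s * s ^ h) (G (suc (h ℕ.+ k))) (G (h ℕ.+ k)) n)
      }

    κ≈dyckSeries : 1 ≤ k → Kappa._≋_ R m s u κ (Kappa.dyckSeries R m s u k)
    κ≈dyckSeries 1≤k n = begin
      κ n
        -- The only factor of `G 1` has exponent 0, and `s ^ 0` is `1#`, so `G 1` agrees with `κ`.
        ≈⟨ *-identityˡ (κ n) ⟨
      1# * κ n
        ≈⟨ *-congʳ (1^ n) ⟨
      1# ^ n * κ n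
        ≈⟨ S.*-identityʳ (κ ⟨r· 1# ⟩) n ⟨
      G 1 n
        -- A Dyck path starts on the line, so `h = 0`, and all its `n` up steps are still to come.
        ≈⟨ ∑pathWeight 1≤k G-recursion (n ℕ.+ k ℕ.* n) 0 n (≡.sym (ℕ.+-identityʳ _)) ⟨
      ListSums.∑ R (paths (n ℕ.+ k ℕ.* n)) (λ μ → pathWeight k μ 0 n)
        ≈⟨ dyckSeries≈∑pathWeight k n ⟨
      Kappa.dyckSeries R m s u k n  ∎
      where
      open SetoidReasoning setoid
      1^ : ∀ n → 1# ^ n ≈ 1#
      1^ zero    = refl
      1^ (suc n) = trans (*-identityˡ _) (1^ n)

proposition4p30 : (k : ℕ) → 2 ≤ k → (κ : ℤ[m,s,u]⟦r⟧) → FunctionalEquation k κ → κ ≋ dyckSeries k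
proposition4p30 k 2≤k κ functional =
  KappaSeries.κ≈dyckSeries ℤ[m,s,u] var-m var-s var-u {k} {κ} functional (ℕ.<⇒≤ 2≤k)
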